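{- Given $\lambda, m, n\in\mathbb{N}$, $\widetilde{\chi}(\lambda K_{n,m})=2$.
   Context: $\mathbb{N}$ denotes the positive integers. A multigraph $G=(V,E)$ is finite and without loops; parallel edges are allowed. For $x\in V$, $E(x)$ denotes the set of edges of $G$ incident to $x$ (parallel edges counted separately). $\lambda K_{n,m}$ is the complete bipartite multigraph with parts of sizes $n$ and $m$ in which every vertex of one part is joined to every vertex of the other part by exactly $\lambda$ parallel edges, and there are no other edges. For an integer $k\ge 2$, a $k$-homogeneous edge-coloring of $G$ is a map $c\colon E\to S$, where $S$ is a set of colors with $|S|=k$ ($c$ is not required to be surjective or proper), such that for every $x\in V$, writing $|E(x)|=k q_x+r_x$ with $0\le r_x<k$, exactly $r_x$ of the colors in $S$ are each assigned to exactly $q_x+1$ edges of $E(x)$, and each of the other $k-r_x$ colors is assigned to exactly $q_x$ edges of $E(x)$. (In particular, if $|E(x)|<k$, the edges of $E(x)$ have pairwise different colors.) The homogeneous chromatic index $\widetilde{\chi}(G)$ is the minimum integer $k\ge 2$ such that $G$ admits a $k$-homogeneous edge-coloring. -}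

module Defs where

open import Data.Fin using (Fin)
open import Data.Fin.Properties using (inj⇒≟; *↔×; +↔⊎) renaming (_≟_ to _≟ᶠ_)
open import Data.Fin.Subset using (Subset; ∣_∣; _∈_; _∉_)
open import Data.List using (List; allFin; filter; length; map)
open import Data.Nat using (ℕ; _+_; _*_; _≤_; _<_)
open import Data.Product using (Σ; ∃; ∃-syntax; _×_; _,_; proj₁; proj₂)
open import Data.Product.Function.NonDependent.Propositional using (_×-↔_)
open import Data.Sum using (_⊎_; inj₁; inj₂)
open import Function.Bundles using (_↔_; Inverse)
open import Function.Properties.Inverse using (↔-refl; ↔-sym; ↔-trans; ↔⇒↣)
open import Relation.Binary.Definitions using (DecidableEquality)
open import Relation.Binary.PropositionalEquality using (_≡_; _≢_)
open import Relation.Nullary.Decidable using (Dec; _⊎-dec_)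

-- The two ends of an edge are stored as an ordered pair, but the order carries
-- no meaning: graphs are undirected, and `loopless` and `Incident` are symmetric
-- in the two ends.
record Multigraph : Set₁ where
  field
    V E      : Set
    order    : ℕ
    size     : ℕ
    V-finite : V ↔ Fin order
    E-finite : E ↔ Fin size
    ends     : E → V × V
    loopless : ∀ e → proj₁ (ends e) ≢ proj₂ (ends e)

  Incident : V → E → Set
  Incident x e = proj₁ (ends e) ≡ x ⊎ proj₂ (ends e) ≡ x

  _≟ⱽ_ : DecidableEquality V
  _≟ⱽ_ = inj⇒≟ (↔⇒↣ V-finite)

  incident? : ∀ x e → Dec (Incident x e)
  incident? x e = (proj₁ (ends e) ≟ⱽ x) ⊎-dec (proj₂ (ends e) ≟ⱽ x)

  -- Lists every edge exactly once, since E-finite is a bijection.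
  edges : List E
  edges = map (Inverse.from E-finite) (allFin size)

  E[_] : V → List E
  E[ x ] = filter (incident? x) edges

  colourCount : ∀ {k} → (E → Fin k) → V → Fin k → ℕ
  colourCount c x s = length (filter (λ e → c e ≟ᶠ s) E[ x ])

open Multigraph

-- R is the set of the r colours that occur q + 1 times at x.
HomogeneousAt : (G : Multigraph) {k : ℕ} → (E G → Fin k) → V G → Set
HomogeneousAt G {k} c x =
  ∃[ q ] ∃[ r ] (length (E[_] G x) ≡ k * q + r) × (r < k) ×
    Σ (Subset k) λ R → (∣ R ∣ ≡ r) ×
      (∀ s → (s ∈ R → colourCount G c x s ≡ q + 1) ×
             (s ∉ R → colourCount G c x s ≡ q))

IsHomogeneousColouring : (G : Multigraph) (k : ℕ) → (E G → Fin k) → Set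
IsHomogeneousColouring G k c = ∀ x → HomogeneousAt G c x

HasHomogeneousColouring : Multigraph → ℕ → Set
HasHomogeneousColouring G k = ∃ (IsHomogeneousColouring G k)

-- The index is presented by its graph: `HomogeneousChromaticIndex G k` says
-- that k is the minimum of the set of all j ≥ 2 for which G has a
-- j-homogeneous edge-colouring.
record HomogeneousChromaticIndex (G : Multigraph) (k : ℕ) : Set where
  field
    at-least-two : 2 ≤ k
    colourable   : HasHomogeneousColouring G k
    minimal      : ∀ j → 2 ≤ j → HasHomogeneousColouring G j → k ≤ j

-- λK_{n,m}, with the multiplicity λ called μ: the edges (i , j , t), t < μ,
-- are the μ parallel edges joining inj₁ i and inj₂ j.
multiK : (μ n m : ℕ) → Multigraph
multiK μ n m = record
  { V        = Fin n ⊎ Fin m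
  ; E        = Fin n × (Fin m × Fin μ)
  ; order    = n + m
  ; size     = n * (m * μ)
  ; V-finite = ↔-sym +↔⊎
  ; E-finite = ↔-trans (↔-refl ×-↔ ↔-sym *↔×) (↔-sym *↔×)
  ; ends     = λ (i , j , _) → inj₁ i , inj₂ j
  ; loopless = λ _ ()
  }

{-# OPTIONS --safe #-}

-- Give the edge (i , j , t) the position (i + j) μ + t and colour it by the
-- parity of its position. Listed lexicographically, the edges at a vertex i of
-- the first part have the consecutive positions i μ, i μ + 1, …, and so do the
-- edges at a vertex j of the second part, starting from j μ. Hence the two
-- colours alternate along the edges at every vertex.
module Submission where

open import Defs
open import Data.Nat using (ℕ; zero; suc; _+_; _*_; _≤_; s≤s; z≤n)
open import Data.Nat.Properties
  using (+-assoc; +-comm; +-identityʳ; +-suc; *-distribʳ-+; ≤-refl)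
open import Data.Nat.Tactic.RingSolver using (solve-∀)
open import Data.Fin using (Fin; zero; suc; toℕ; opposite; combine; _↑ˡ_; _↑ʳ_)
open import Data.Fin.Properties using (opposite-involutive) renaming (_≟_ to _≟ᶠ_)
open import Data.Fin.Subset using (_∈_; ⁅_⁆; ⊥)
open import Data.Fin.Subset.Properties using (x∈⁅x⁆; x∈⁅y⁆⇒x≡y; ∉⊥; ∣⁅x⁆∣≡1)
open import Data.List using (List; []; _∷_; _++_; concat; filter; length; tabulate)
open import Data.List.Properties
  using (filter-accept; filter-reject; filter-all; filter-none; filter-++;
         map-tabulate; tabulate-cong; ++-identityʳ)
open import Data.List.Relation.Unary.All using (All)
open import Data.List.Relation.Unary.All.Properties using (concat⁺; tabulate⁺)
open import Data.Product using (_,_)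
open import Data.Sum using (inj₁; inj₂)
open import Data.Sum.Properties using (inj₁-injective; inj₂-injective)
open import Function using (_∘_; id)
open import Function.Bundles using (Inverse)
open import Level using (0ℓ)
open import Relation.Binary.PropositionalEquality
  using (_≡_; _≢_; refl; sym; trans; cong; cong₂; subst; module ≡-Reasoning)
open import Relation.Nullary using (¬_; contradiction; yes; no)
open import Relation.Unary using (Pred; Decidable)

open Multigraph

private variable
  A : Set
  P : Pred A 0ℓ

tabulate-++ : ∀ p {q} (f : Fin (p + q) → A) →
  tabulate f ≡ tabulate (f ∘ (_↑ˡ q)) ++ tabulate (f ∘ (p ↑ʳ_))
tabulate-++ zero    f = refl
tabulate-++ (suc p) f = cong (f zero ∷_) (tabulate-++ p (f ∘ suc))

-- `combine` numbers pairs lexicographically, so the flat enumeration falls into `p` consecutive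
-- blocks of length `q`. This exposes the product structure hidden in `edges`.
tabulate-combine : ∀ p {q} (f : Fin (p * q) → A) →
  tabulate f ≡ concat (tabulate λ i → tabulate λ j → f (combine {p} i j))
tabulate-combine zero        f = refl
tabulate-combine (suc p) {q} f = trans (tabulate-++ q f)
  (cong (tabulate (f ∘ (_↑ˡ (p * q))) ++_) (tabulate-combine p (f ∘ (q ↑ʳ_))))

concat-tabulate-[] : ∀ {p} {xs : Fin p → List A} → (∀ i → xs i ≡ []) →
  concat (tabulate xs) ≡ []
concat-tabulate-[] {p = zero}  eq = refl
concat-tabulate-[] {p = suc p} eq =
  cong₂ _++_ (eq zero) (concat-tabulate-[] (eq ∘ suc))

concat-tabulate-unique : ∀ {p} {xs : Fin p → List A} i → (∀ j → j ≢ i → xs j ≡ []) →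
  concat (tabulate xs) ≡ xs i
concat-tabulate-unique {xs = xs} zero eq =
  trans (cong (xs zero ++_) (concat-tabulate-[] λ j → eq (suc j) λ ()))
        (++-identityʳ (xs zero))
concat-tabulate-unique (suc i) eq =
  cong₂ _++_ (eq zero λ ())
    (concat-tabulate-unique i λ j j≢i → eq (suc j) λ { refl → j≢i refl })

filter-concat-tabulate : ∀ {p} (P? : Decidable P) (xs : Fin p → List A) →
  filter P? (concat (tabulate xs)) ≡ concat (tabulate (filter P? ∘ xs))
filter-concat-tabulate {p = zero}  P? xs = refl
filter-concat-tabulate {p = suc p} P? xs =
  trans (filter-++ P? (xs zero) _)
        (cong (filter P? (xs zero) ++_) (filter-concat-tabulate P? (xs ∘ suc)))

-- Meant for `P` being incidence with a vertex: among the blocks of edges at one level of the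
-- enumeration, one block passes whole and all others vanish.
filter-concat-tabulate-unique : ∀ {p} (P? : Decidable P) (xs : Fin p → List A) i →
  All P (xs i) → (∀ j → j ≢ i → All (¬_ ∘ P) (xs j)) →
  filter P? (concat (tabulate xs)) ≡ xs i
filter-concat-tabulate-unique P? xs i all none =
  trans (filter-concat-tabulate P? xs)
    (trans (concat-tabulate-unique i λ j j≢i → filter-none P? (none j j≢i))
           (filter-all P? all))

-- The values of f along the list are a, a + 1, …, b - 1.
data Run (f : A → ℕ) : ℕ → ℕ → List A → Set where
  []  : ∀ {a} → Run f a a []
  _∷_ : ∀ {a b x xs} → f x ≡ a → Run f (suc a) b xs → Run f a b (x ∷ xs)

module _ {f : A → ℕ} where

  Run-++ : ∀ {a b c xs ys} → Run f a b xs → Run f b c ys → Run f a c (xs ++ ys)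
  Run-++ []       ys = ys
  Run-++ (p ∷ xs) ys = p ∷ Run-++ xs ys

  Run-tabulate : ∀ p {a} {g : Fin p → A} → (∀ i → f (g i) ≡ a + toℕ i) →
    Run f a (a + p) (tabulate g)
  Run-tabulate zero    {a} eq rewrite +-identityʳ a = []
  Run-tabulate (suc p) {a} eq rewrite +-suc a p =
    trans (eq zero) (+-identityʳ a) ∷
    Run-tabulate p λ i → trans (eq (suc i)) (+-suc a (toℕ i))

  Run-concat : ∀ p {w a} {xs : Fin p → List A} →
    (∀ i → Run f (a + toℕ i * w) (a + toℕ i * w + w) (xs i)) →
    Run f a (a + p * w) (concat (tabulate xs))
  Run-concat zero        {a = a} runs rewrite +-identityʳ a = []
  Run-concat (suc p) {w} {a} {xs} runs = Run-++
    -- The remaining blocks form the same situation with starting value `a + w`; the transports only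
    -- reassociate sums.
    (subst (λ o → Run f o (o + w) (xs zero)) (+-identityʳ a) (runs zero))
    (subst (λ o → Run f (a + w) o (concat (tabulate (xs ∘ suc)))) (+-assoc a w (p * w))
      (Run-concat p λ i → subst (λ o → Run f o (o + w) (xs (suc i)))
        (sym (+-assoc a w (toℕ i * w))) (runs (suc i))))

-- `opposite` swaps the two elements of `Fin 2`, so this is the residue modulo 2.
parity : ℕ → Fin 2
parity zero    = zero
parity (suc n) = opposite (parity n)

count : ∀ {k} → (A → Fin k) → Fin k → List A → ℕ
count c s xs = length (filter (λ x → c x ≟ᶠ s) xs)

opposite≢ : ∀ (s : Fin 2) → s ≢ opposite s
opposite≢ zero       ()
opposite≢ (suc zero) ()

≢⇒≡opposite : ∀ {s t : Fin 2} → t ≢ s → t ≡ opposite s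
≢⇒≡opposite {zero}     {zero}     t≢s = contradiction refl t≢s
≢⇒≡opposite {zero}     {suc zero} t≢s = refl
≢⇒≡opposite {suc zero} {zero}     t≢s = refl
≢⇒≡opposite {suc zero} {suc zero} t≢s = contradiction refl t≢s

module _ (c : A → Fin 2) (x : A) (xs : List A) where

  count-≡ : ∀ {s} → c x ≡ s → count c s (x ∷ xs) ≡ suc (count c s xs)
  count-≡ eq = cong length (filter-accept (λ x → c x ≟ᶠ _) {xs = xs} eq)

  count-opposite : ∀ {s} → c x ≡ s → count c (opposite s) (x ∷ xs) ≡ count c (opposite s) xs
  count-opposite {s} eq = cong length
    (filter-reject (λ x → c x ≟ᶠ opposite s) λ eq′ → opposite≢ s (trans (sym eq) eq′))

-- The invariant of an alternating list that starts with colour `s`: only `s` can be in surplus.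
-- Recording which colour may lead is what makes the induction work.
data Balanced (c : A → Fin 2) (s : Fin 2) (xs : List A) : Set where
  equal  : ∀ q → length xs ≡ 2 * q →
           count c s xs ≡ q → count c (opposite s) xs ≡ q → Balanced c s xs
  excess : ∀ q → length xs ≡ 2 * q + 1 →
           count c s xs ≡ q + 1 → count c (opposite s) xs ≡ q → Balanced c s xs

-- The new element of colour `s` cancels a surplus of `opposite s` in the tail, or else creates a
-- surplus of `s`.
Balanced-∷ : ∀ {c : A → Fin 2} {s x xs} → c x ≡ s →
  Balanced c (opposite s) xs → Balanced c s (x ∷ xs)
-- In the tail `other` counts `opposite (opposite s)`, which is `s`, so `same` and `other` exchange
-- roles.
Balanced-∷ {c = c} {s} {x} {xs} cx≡s (equal q len same other) rewrite opposite-involutive s =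
  excess q (trans (cong suc len) (+-comm 1 (2 * q)))
    (trans (count-≡ c x xs cx≡s) (trans (cong suc other) (+-comm 1 q)))
    (trans (count-opposite c x xs cx≡s) same)
Balanced-∷ {c = c} {s} {x} {xs} cx≡s (excess q len same other) rewrite opposite-involutive s =
  equal (suc q) (trans (cong suc len) (lemma q))
    (trans (count-≡ c x xs cx≡s) (cong suc other))
    (trans (count-opposite c x xs cx≡s) (trans same (+-comm q 1)))
  where
  lemma : ∀ q → suc (2 * q + 1) ≡ 2 * suc q
  lemma = solve-∀

-- `parity (suc a)` reduces to `opposite (parity a)`, so the tail of a run has the leading colour
-- that `Balanced-∷` expects.
Run⇒Balanced : ∀ {f : A → ℕ} {a b xs} → Run f a b xs → Balanced (parity ∘ f) (parity a) xs
Run⇒Balanced []         = equal 0 refl refl refl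
Run⇒Balanced (fx≡a ∷ r) = Balanced-∷ (cong parity fx≡a) (Run⇒Balanced r)

-- The degree leaves remainder 0 or 1, and the surplus set is `⊥` or `⁅ s ⁆` accordingly. With two
-- colours, any colour other than `s` is `opposite s`, so the two recorded counts cover every
-- colour.
Balanced⇒HomogeneousAt : ∀ G {c : E G → Fin 2} {x s} →
  Balanced c s (E[_] G x) → HomogeneousAt G c x
Balanced⇒HomogeneousAt G {c} {x} {s} (equal q len same other) =
  q , 0 , trans len (sym (+-identityʳ (2 * q))) , s≤s z≤n , ⊥ , refl ,
  λ t → (λ t∈⊥ → contradiction t∈⊥ ∉⊥) , λ _ → counts t
  where
  counts : ∀ t → colourCount G c x t ≡ q
  counts t with t ≟ᶠ s
  ... | yes refl = same
  ... | no t≢s rewrite ≢⇒≡opposite t≢s = other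
Balanced⇒HomogeneousAt G {c} {x} {s} (excess q len same other) =
  q , 1 , len , ≤-refl , ⁅ s ⁆ , ∣⁅x⁆∣≡1 s ,
  λ t → (λ t∈ → subst (λ t → colourCount G c x t ≡ q + 1) (sym (x∈⁅y⁆⇒x≡y s t∈)) same) ,
         λ t∉ → subst (λ t → colourCount G c x t ≡ q)
           (sym (≢⇒≡opposite {s} {t} λ t≡s → t∉ (subst (_∈ ⁅ s ⁆) (sym t≡s) (x∈⁅x⁆ s)))) other

module _ (μ n m : ℕ) where

  private
    G : Multigraph
    G = multiK μ n m

  parallel : Fin n → Fin m → List (E G)
  parallel i j = tabulate λ t → i , j , t

  star : Fin n → List (E G)
  star i = concat (tabulate (parallel i))

  -- `E-finite` encodes `(i , j , t)` as `combine i (combine j t)`. Splitting the index range twice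
  -- therefore leaves `from` applied to codes of edges, where it cancels.
  edges≡ : edges G ≡ concat (tabulate star)
  edges≡ = begin
    edges G
      ≡⟨ map-tabulate id from ⟩
    tabulate from
      ≡⟨ tabulate-combine n from ⟩
    concat (tabulate λ i → tabulate λ l → from (combine {n} i l))
      ≡⟨ cong concat (tabulate-cong λ i → tabulate-combine m (from ∘ combine {n} i)) ⟩
    concat (tabulate λ i → concat (tabulate λ j → tabulate λ t → from (combine {n} i (combine {m} j t))))
      ≡⟨ cong concat (tabulate-cong λ i → cong concat (tabulate-cong λ j →
           tabulate-cong λ t → Inverse.strictlyInverseʳ (E-finite G) (i , j , t))) ⟩
    concat (tabulate star) ∎
    where
    open ≡-Reasoning
    from = Inverse.from (E-finite G)

  E[inj₁] : ∀ i → E[_] G (inj₁ i) ≡ star i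
  E[inj₁] i = trans (cong (filter (incident? G (inj₁ i))) edges≡)
    (filter-concat-tabulate-unique (incident? G (inj₁ i)) star i
      (concat⁺ (tabulate⁺ {f = parallel i} λ j → tabulate⁺ λ t → inj₁ refl))
      λ i′ i′≢i → concat⁺ (tabulate⁺ {f = parallel i′} λ j → tabulate⁺ λ t →
        -- The second end lies in the other part, so only the first end can equal `inj₁ i`.
        λ { (inj₁ eq) → i′≢i (inj₁-injective eq) }))

  -- These edges need not be contiguous in the enumeration: every star contributes its own block of
  -- parallel edges, so each star is filtered separately.
  E[inj₂] : ∀ j → E[_] G (inj₂ j) ≡ concat (tabulate λ i → parallel i j)
  E[inj₂] j = begin
    filter at-j? (edges G)
      ≡⟨ cong (filter at-j?) edges≡ ⟩
    filter at-j? (concat (tabulate star))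
      ≡⟨ filter-concat-tabulate at-j? star ⟩
    concat (tabulate (filter at-j? ∘ star))
      ≡⟨ cong concat (tabulate-cong λ i → filter-concat-tabulate-unique at-j? (parallel i) j
           (tabulate⁺ λ t → inj₂ refl)
           λ j′ j′≢j → tabulate⁺ λ t → λ { (inj₂ eq) → j′≢j (inj₂-injective eq) }) ⟩
    concat (tabulate λ i → parallel i j) ∎
    where
    open ≡-Reasoning
    at-j? = incident? G (inj₂ j)

  position : E G → ℕ
  position (i , j , t) = (toℕ i + toℕ j) * μ + toℕ t

  Run-inj₁ : ∀ i → Run position (toℕ i * μ) (toℕ i * μ + m * μ) (E[_] G (inj₁ i))
  Run-inj₁ i rewrite E[inj₁] i = Run-concat m λ j → Run-tabulate μ λ t →
    cong (_+ toℕ t) (*-distribʳ-+ μ (toℕ i) (toℕ j))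

  Run-inj₂ : ∀ j → Run position (toℕ j * μ) (toℕ j * μ + n * μ) (E[_] G (inj₂ j))
  Run-inj₂ j rewrite E[inj₂] j = Run-concat n λ i → Run-tabulate μ λ t →
    -- Here `j` is fixed and `i` numbers the blocks, so the constant offset `toℕ j * μ` has to come
    -- first.
    cong (_+ toℕ t) (trans (*-distribʳ-+ μ (toℕ i) (toℕ j)) (+-comm (toℕ i * μ) (toℕ j * μ)))

  homogeneous : IsHomogeneousColouring G 2 (parity ∘ position)
  homogeneous (inj₁ i) = Balanced⇒HomogeneousAt G (Run⇒Balanced (Run-inj₁ i))
  homogeneous (inj₂ j) = Balanced⇒HomogeneousAt G (Run⇒Balanced (Run-inj₂ j))

theorem4p3 : (μ m n : ℕ) → 1 ≤ μ → 1 ≤ m → 1 ≤ n →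
    HomogeneousChromaticIndex (multiK μ n m) 2
theorem4p3 μ m n _ _ _ = record
  { at-least-two = ≤-refl
  ; colourable   = parity ∘ position μ n m , homogeneous μ n m
  -- The minimum ranges over numbers that are at least 2, and the parity colouring attains this
  -- bound.
  ; minimal      = λ _ 2≤j _ → 2≤j
  }
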